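{- Let $(G_m)_{m\in\mathbb{Z}}$ be a generalized Fibonacci sequence, let $a,b$ be integers, let $n\ge 0$ be an integer, and let $x$ be a complex number such that $\Delta := 1-L_b x+(-1)^b x^2\neq 0$. Then $$\begin{aligned} \sum_{k=0}^n x^k k^4 G_{a+bk} = {}& -\frac{1}{\Delta}(n+1)^4 x^{n+1} P(1,n+1) \\ & - \frac{1}{\Delta^2} \left[ (4n^3+18n^2+28n+15) x^{n+2} P(2,n+2) - x P(2,1) \right] \\ & - \frac{2}{\Delta^3} \left[ (6n^2+24n+25) x^{n+3} P(3,n+3) - 7 x^2 P(3,2) \right] \\ & - \frac{12}{\Delta^4} \left[ (2n+5) x^{n+4} P(4,n+4) - 3 x^3 P(4,3) \right] \\ & - \frac{24}{\Delta^5} \left[ x^{n+5} P(5,n+5) - x^4 P(5,4) \right]. \end{aligned}$$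
   Context: A generalized Fibonacci sequence is a sequence $(G_m)_{m\in\mathbb{Z}}$ of complex numbers with $G_{m+2}=G_{m+1}+G_m$ for all integers $m$ (with arbitrary seed $G_0,G_1$). $L_m$ is the Lucas number: $L_0=2$, $L_1=1$, $L_{m+2}=L_{m+1}+L_m$ for all integers $m$ (including negative indices). For given $a,b,x$ and $G$, and for integers $v,w\ge 0$, $P(v,w) = \sum_{k=0}^v \binom{v}{k} (-1)^{(b+1)k} x^k G_{a+bw-bk}$. Convention: $x^0=1$, also for $x=0$. -}

module Defs where

open import Algebra.Apartness.Bundles using (HeytingField; HeytingCommutativeRing)
open import Algebra.Bundles using (CommutativeRing)
open import Data.Fin.Base using (toℕ)
open import Data.Integer.Base as ℤ using (ℤ; +_; -[1+_])
open import Data.Integer.Tactic.RingSolver using (solve-∀)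
open import Data.Nat.Base using (ℕ; zero; suc)
open import Data.Nat.Combinatorics using (_C_)
open import Data.Product.Base using (proj₁)
open import Relation.Binary.PropositionalEquality using (_≡_; refl)

-- For negative indices the recurrence is run backwards: L m = L (m + 2) - L (m + 1).
L : ℤ → ℤ
L (+ 0)               = + 2
L (+ 1)               = + 1
L (+ suc (suc n))     = L (+ suc n) ℤ.+ L (+ n)
L -[1+ 0 ]            = L (+ 1) ℤ.- L (+ 0)
L -[1+ 1 ]            = L (+ 0) ℤ.- L -[1+ 0 ]
L -[1+ suc (suc n) ]  = L -[1+ n ] ℤ.- L -[1+ suc n ]

L-recurrence : ∀ m → L (m ℤ.+ + 2) ≡ L (m ℤ.+ + 1) ℤ.+ L m
L-recurrence (+ 0)               = refl
L-recurrence (+ 1)               = refl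
L-recurrence (+ suc (suc n))     = L-recurrence⁺ (suc (suc n))
  where
  open import Data.Nat.Properties using (+-comm)
  L-recurrence⁺ : ∀ k → L (+ k ℤ.+ + 2) ≡ L (+ k ℤ.+ + 1) ℤ.+ L (+ k)
  L-recurrence⁺ k rewrite +-comm k 2 | +-comm k 1 = refl
L-recurrence -[1+ 0 ]            = refl
L-recurrence -[1+ 1 ]            = refl
L-recurrence -[1+ suc (suc n) ]  = cancel (L -[1+ n ]) (L -[1+ suc n ])
  where
  cancel : ∀ i j → i ≡ j ℤ.+ (i ℤ.- j)
  cancel = solve-∀

-- HeytingField is the library's notion of a field, in which "x ≠ 0" is the
-- apartness x # 0#, i.e. the form of non-vanishing that permits division by x.
module GeneralizedFibonacci {c ℓ₁ ℓ₂} (K : HeytingField c ℓ₁ ℓ₂) where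

  open HeytingField K

  private
    ring : CommutativeRing c ℓ₁
    ring = HeytingCommutativeRing.commutativeRing heytingCommutativeRing

  open import Algebra.Properties.Semiring.Exp (CommutativeRing.semiring ring) public using (_^_)
  open import Algebra.Properties.Semiring.Mult (CommutativeRing.semiring ring) using (_×_)
  open import Algebra.Properties.Semiring.Sum (CommutativeRing.semiring ring) public using (sum⁺-syntax)

  ι : ℕ → Carrier
  ι n = n × 1#

  fromℤ : ℤ → Carrier
  fromℤ (+ n)    = ι n
  fromℤ -[1+ n ] = - ι (suc n)

  -- (-1)^m for an arbitrary integer m; since -1 is its own inverse, the
  -- exponent may be replaced by its absolute value.
  [-1]^ : ℤ → Carrier
  [-1]^ m = (- 1#) ^ ℤ.∣ m ∣

  -- The library's #⇒invertible inverts the difference x - 0#.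
  inverse : ∀ {x} → x # 0# → Carrier
  inverse x#0 = proj₁ (#⇒invertible x#0)

  IsGeneralizedFibonacci : (ℤ → Carrier) → Set ℓ₁
  IsGeneralizedFibonacci G = ∀ m → G (m ℤ.+ + 2) ≈ G (m ℤ.+ + 1) + G m

  P : (G : ℤ → Carrier) (a b : ℤ) (x : Carrier) → ℕ → ℕ → Carrier
  P G a b x v w =
    ∑[ k ≤ v ] ( ι (v C toℕ k) * [-1]^ ((b ℤ.+ + 1) ℤ.* + toℕ k) * x ^ toℕ k
                 * G (a ℤ.+ b ℤ.* + w ℤ.- b ℤ.* + toℕ k) )

{-# OPTIONS --safe #-}
-- Put e = (-1)^b and write Q_v(m) for the binomial sum with P(v,w) = Q_v(a + bw).
-- Pascal's rule gives Q_{v+1}(m) = Q_v(m) - e x Q_v(m - b), and every Q_v is again a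
-- generalized Fibonacci sequence, so Q_v(m + b) + e Q_v(m - b) = L_b Q_v(m).  Hence
-- Δ Q_v(m) = Q_{v+1}(m) - x Q_{v+1}(m + b), i.e. x^w P(v,w) telescopes as
-- (x^w P(v+1,w) - x^{w+1} P(v+1,w+1)) / Δ.  Five summations by parts, each replacing
-- the weight by its forward difference, annihilate the weight k^4 and leave exactly
-- the boundary terms.
module Submission where

open import Defs
open import Algebra.Apartness.Bundles using (HeytingField; HeytingCommutativeRing)
open import Algebra.Bundles using (CommutativeRing)
open import Algebra.Solver.Ring.AlmostCommutativeRing using (fromCommutativeRing; _-Raw-AlmostCommutative⟶_)
open import Data.Fin.Base using (toℕ; fromℕ; inject₁)
open import Data.Fin.Patterns using (0F)
open import Data.Fin.Properties using (toℕ-fromℕ; toℕ-inject₁)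
open import Data.Integer.Base as ℤ using (ℤ; +_; -[1+_])
import Data.Integer.Properties as ℤ
open import Data.Integer.Tactic.RingSolver using (solve-∀)
open import Data.Maybe.Base as Maybe using (Maybe)
open import Data.Nat.Base as ℕ using (ℕ; zero; suc)
open import Data.Nat.Combinatorics using (_C_; nCk+nC[k+1]≡[n+1]C[k+1]; k>n⇒nCk≡0)
import Data.Nat.Properties as ℕ
open import Data.Product.Base using (_×_; _,_; proj₁; proj₂)
import Data.Sign.Base as Sign
open import Data.Vec.Base using ([]; _∷_)
open import Function.Base using (_∘_)
open import Relation.Binary.Consequences using (dec⇒weaklyDec)
open import Relation.Binary.PropositionalEquality as ≡ using (_≡_)

module FibonacciSums {c ℓ₁ ℓ₂} (K : HeytingField c ℓ₁ ℓ₂) where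

  open HeytingField K
  open GeneralizedFibonacci K

  private
    ring : CommutativeRing c ℓ₁
    ring = HeytingCommutativeRing.commutativeRing heytingCommutativeRing

  open CommutativeRing ring using (semiring) renaming (ring to noncommutativeRing)
  open import Algebra.Properties.Ring noncommutativeRing using (-‿distribˡ-*; -‿distribʳ-*; -‿involutive; -0#≈0#; -‿+-comm)
  open import Algebra.Properties.Semiring.Exp semiring using (^-homo-*)
  open import Algebra.Properties.Semiring.Mult semiring using (×-homo-+; ×1-homo-*)
  open import Algebra.Properties.Semiring.Sum semiring using (sum-cong-≋; sum-init-last; sum-replicate-zero; ∑-distrib-+; *-distribˡ-sum)
  open import Relation.Binary.Reasoning.Setoid setoid

  -- Integer constants in the field, and the ring solver built on them.

  ι-homo-+ : ∀ m n → ι (m ℕ.+ n) ≈ ι m + ι n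
  ι-homo-+ = ×-homo-+ 1#

  -- This is the mixed-sign case of additivity: a common successor on both sides contributes 1 - 1,
  -- which cancels.
  fromℤ-⊖ : ∀ m n → fromℤ (m ℤ.⊖ n) ≈ ι m - ι n
  fromℤ-⊖ m       zero    = sym (trans (+-congˡ -0#≈0#) (+-identityʳ (ι m)))
  fromℤ-⊖ zero    (suc n) = sym (+-identityˡ _)
  fromℤ-⊖ (suc m) (suc n) = begin
    fromℤ (suc m ℤ.⊖ suc n)                 ≡⟨ ≡.cong fromℤ (ℤ.[1+m]⊖[1+n]≡m⊖n m n) ⟩
    fromℤ (m ℤ.⊖ n)                         ≈⟨ fromℤ-⊖ m n ⟩
    ι m - ι n                               ≈⟨ +-congʳ (+-identityˡ (ι m)) ⟨
    0# + ι m - ι n                          ≈⟨ +-congʳ (+-congʳ (-‿inverseʳ 1#)) ⟨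
    1# - 1# + ι m - ι n                     ≈⟨ +-congʳ (+-assoc 1# (- 1#) (ι m)) ⟩
    1# + (- 1# + ι m) - ι n                 ≈⟨ +-congʳ (+-congˡ (+-comm (- 1#) (ι m))) ⟩
    1# + (ι m - 1#) - ι n                   ≈⟨ +-congʳ (+-assoc 1# (ι m) (- 1#)) ⟨
    1# + ι m - 1# - ι n                     ≈⟨ +-assoc (1# + ι m) (- 1#) (- ι n) ⟩
    1# + ι m + (- 1# - ι n)                 ≈⟨ +-congˡ (-‿+-comm 1# (ι n)) ⟩
    ι (suc m) - ι (suc n)                   ∎

  fromℤ-homo-+ : ∀ i j → fromℤ (i ℤ.+ j) ≈ fromℤ i + fromℤ j
  fromℤ-homo-+ (+ m)    (+ n)    = ι-homo-+ m n
  fromℤ-homo-+ (+ m)    -[1+ n ] = fromℤ-⊖ m (suc n)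
  fromℤ-homo-+ -[1+ m ] (+ n)    = trans (fromℤ-⊖ n (suc m)) (+-comm _ _)
  fromℤ-homo-+ -[1+ m ] -[1+ n ] = begin
    - ι (suc (suc (m ℕ.+ n)))  ≡⟨ ≡.cong (λ k → - ι (suc k)) (ℕ.+-suc m n) ⟨
    - ι (suc m ℕ.+ suc n)      ≈⟨ -‿cong (ι-homo-+ (suc m) (suc n)) ⟩
    - (ι (suc m) + ι (suc n))  ≈⟨ -‿+-comm (ι (suc m)) (ι (suc n)) ⟨
    - ι (suc m) - ι (suc n)    ∎

  fromℤ-homo‿- : ∀ i → fromℤ (ℤ.- i) ≈ - fromℤ i
  fromℤ-homo‿- (+ zero)  = sym -0#≈0#
  fromℤ-homo‿- (+ suc n) = refl
  fromℤ-homo‿- -[1+ n ]  = sym (-‿involutive (ι (suc n)))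

  fromℤ-homo-* : ∀ i j → fromℤ (i ℤ.* j) ≈ fromℤ i * fromℤ j
  fromℤ-homo-* (+ m)    (+ n)    = begin
    fromℤ (Sign.+ ℤ.◃ m ℕ.* n)  ≡⟨ ≡.cong fromℤ (ℤ.+◃n≡+n (m ℕ.* n)) ⟩
    ι (m ℕ.* n)                 ≈⟨ ×1-homo-* m n ⟩
    ι m * ι n                   ∎
  fromℤ-homo-* (+ m)    -[1+ n ] = begin
    fromℤ (Sign.- ℤ.◃ m ℕ.* suc n)  ≡⟨ ≡.cong fromℤ (ℤ.-◃n≡-n (m ℕ.* suc n)) ⟩
    fromℤ (ℤ.- + (m ℕ.* suc n))     ≈⟨ fromℤ-homo‿- (+ (m ℕ.* suc n)) ⟩
    - ι (m ℕ.* suc n)               ≈⟨ -‿cong (×1-homo-* m (suc n)) ⟩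
    - (ι m * ι (suc n))             ≈⟨ -‿distribʳ-* (ι m) (ι (suc n)) ⟩
    ι m * - ι (suc n)               ∎
  fromℤ-homo-* -[1+ m ] (+ n)    = begin
    fromℤ (Sign.- ℤ.◃ suc m ℕ.* n)  ≡⟨ ≡.cong fromℤ (ℤ.-◃n≡-n (suc m ℕ.* n)) ⟩
    fromℤ (ℤ.- + (suc m ℕ.* n))     ≈⟨ fromℤ-homo‿- (+ (suc m ℕ.* n)) ⟩
    - ι (suc m ℕ.* n)               ≈⟨ -‿cong (×1-homo-* (suc m) n) ⟩
    - (ι (suc m) * ι n)             ≈⟨ -‿distribˡ-* (ι (suc m)) (ι n) ⟩
    - ι (suc m) * ι n               ∎
  fromℤ-homo-* -[1+ m ] -[1+ n ] = begin
    ι (suc m ℕ.* suc n)             ≈⟨ ×1-homo-* (suc m) (suc n) ⟩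
    ι (suc m) * ι (suc n)           ≈⟨ -‿involutive _ ⟨
    - - (ι (suc m) * ι (suc n))     ≈⟨ -‿cong (-‿distribˡ-* _ _) ⟩
    - (- ι (suc m) * ι (suc n))     ≈⟨ -‿distribʳ-* _ _ ⟩
    - ι (suc m) * - ι (suc n)       ∎

  fromℤ-homomorphism : CommutativeRing.rawRing ℤ.+-*-commutativeRing -Raw-AlmostCommutative⟶ fromCommutativeRing ring
  fromℤ-homomorphism = record
    { ⟦_⟧    = fromℤ
    ; +-homo = fromℤ-homo-+
    ; *-homo = fromℤ-homo-*
    ; -‿homo = fromℤ-homo‿-
    ; 0-homo = refl
    ; 1-homo = +-identityʳ 1#
    }

  -- Equality in `K` need not be decidable, so the solver compares coefficients as integers. Equal
  -- integers have equal images, which is all that soundness requires.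
  fromℤ-≟ : ∀ i j → Maybe (fromℤ i ≈ fromℤ j)
  fromℤ-≟ i j = Maybe.map (λ i≡j → reflexive (≡.cong fromℤ i≡j)) (dec⇒weaklyDec ℤ._≟_ i j)

  open import Algebra.Solver.Ring _ _ fromℤ-homomorphism fromℤ-≟
    public using (Polynomial; con; var; ⟦_⟧; solve; _:=_; _:+_; _:*_; _:-_; :-_; _:^_)

  :ι : ∀ {k} → ℕ → Polynomial k
  :ι n = con (+ n)

  -- con (+ 1) denotes ι 1, i.e. 1# + 0#, whereas a zeroth power denotes 1# itself.
  :1 : ∀ {k} → Polynomial k
  :1 = con (+ 0) :^ 0

  -- Signs, uniqueness of generalized Fibonacci sequences, and the Lucas identity.

  [-1]^-suc : ∀ m → [-1]^ (m ℤ.+ + 1) ≈ - [-1]^ m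
  [-1]^-suc (+ n)        = begin
    (- 1#) ^ (n ℕ.+ 1)  ≡⟨ ≡.cong ((- 1#) ^_) (ℕ.+-comm n 1) ⟩
    - 1# * (- 1#) ^ n   ≈⟨ solve 1 (λ e → :- :1 :* e := :- e) refl ((- 1#) ^ n) ⟩
    - (- 1#) ^ n        ∎
  -- Below zero, adding one to the index lowers the exponent, which is an absolute value. The factor
  -- -1 lost there is made good by (-1)(-1) = 1.
  [-1]^-suc -[1+ zero ]  = solve 0 (:1 := :- (:- :1 :* :1)) refl
  [-1]^-suc -[1+ suc n ] = solve 1 (λ e → e := :- (:- :1 :* e)) refl ((- 1#) ^ suc n)

  module _ {F H : ℤ → Carrier}
           (F-fib : IsGeneralizedFibonacci F) (H-fib : IsGeneralizedFibonacci H)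
           (F₀≈H₀ : F (+ 0) ≈ H (+ 0)) (F₁≈H₁ : F (+ 1) ≈ H (+ 1)) where

    private
      -- Adjacent values are carried in pairs because the recurrence has order two.
      agree⁺ : ∀ n → F (+ n) ≈ H (+ n) × F (+ suc n) ≈ H (+ suc n)
      agree⁺ zero    = F₀≈H₀ , F₁≈H₁
      agree⁺ (suc n) with agree⁺ n
      ... | eq₀ , eq₁ = eq₁ , (begin
        F (+ suc (suc n))          ≡⟨ ≡.cong F (i≡ 2) ⟨
        F (+ n ℤ.+ + 2)            ≈⟨ F-fib (+ n) ⟩
        F (+ n ℤ.+ + 1) + F (+ n)  ≡⟨ ≡.cong (λ i → F i + F (+ n)) (i≡ 1) ⟩
        F (+ suc n) + F (+ n)      ≈⟨ +-cong eq₁ eq₀ ⟩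
        H (+ suc n) + H (+ n)      ≡⟨ ≡.cong (λ i → H i + H (+ n)) (i≡ 1) ⟨
        H (+ n ℤ.+ + 1) + H (+ n)  ≈⟨ H-fib (+ n) ⟨
        H (+ n ℤ.+ + 2)            ≡⟨ ≡.cong H (i≡ 2) ⟩
        H (+ suc (suc n))          ∎)
        where
        i≡ : ∀ k → + n ℤ.+ + k ≡ + (k ℕ.+ n)
        i≡ k = ≡.cong +_ (ℕ.+-comm n k)

      previous : ∀ {E} → IsGeneralizedFibonacci E → ∀ m → E m ≈ E (m ℤ.+ + 2) - E (m ℤ.+ + 1)
      previous {E} E-fib m = begin
        E m                                  ≈⟨ solve 2 (λ y z → z := y :+ z :- y) refl (E (m ℤ.+ + 1)) (E m) ⟩
        E (m ℤ.+ + 1) + E m - E (m ℤ.+ + 1)  ≈⟨ +-congʳ (E-fib m) ⟨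
        E (m ℤ.+ + 2) - E (m ℤ.+ + 1)        ∎

      -- Downwards, the recurrence solved for its lowest term (`previous`) yields the value at -n -
      -- 1 from the pair at -n and -n + 1.
      agree⁻ : ∀ n → F (ℤ.- + n) ≈ H (ℤ.- + n) × F (ℤ.- + n ℤ.+ + 1) ≈ H (ℤ.- + n ℤ.+ + 1)
      agree⁻ zero    = F₀≈H₀ , F₁≈H₁
      agree⁻ (suc n) with agree⁻ n
      ... | eq₀ , eq₁ = eq₋₁ , ≡.subst (λ i → F i ≈ H i) (≡.sym 1+) eq₀
        where
        m = ℤ.- + suc n
        1+ : m ℤ.+ + 1 ≡ ℤ.- + n
        1+ = ≡.trans (≡.cong (ℤ._+ + 1) (ℤ.neg-distrib-+ (+ 1) (+ n))) (lem (ℤ.- + n))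
          where
          lem : ∀ i → ℤ.- + 1 ℤ.+ i ℤ.+ + 1 ≡ i
          lem = solve-∀
        2+ : m ℤ.+ + 2 ≡ ℤ.- + n ℤ.+ + 1
        2+ = ≡.trans (≡.sym (ℤ.+-assoc m (+ 1) (+ 1))) (≡.cong (ℤ._+ + 1) 1+)
        eq₋₁ : F m ≈ H m
        eq₋₁ = begin
          F m                            ≈⟨ previous F-fib m ⟩
          F (m ℤ.+ + 2) - F (m ℤ.+ + 1)  ≡⟨ ≡.cong₂ (λ i j → F i - F j) 2+ 1+ ⟩
          F (ℤ.- + n ℤ.+ + 1) - F (ℤ.- + n)  ≈⟨ +-cong eq₁ (-‿cong eq₀) ⟩
          H (ℤ.- + n ℤ.+ + 1) - H (ℤ.- + n)  ≡⟨ ≡.cong₂ (λ i j → H i - H j) 2+ 1+ ⟨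
          H (m ℤ.+ + 2) - H (m ℤ.+ + 1)  ≈⟨ previous H-fib m ⟨
          H m                            ∎

    fibonacci-unique : ∀ m → F m ≈ H m
    fibonacci-unique (+ n)    = proj₁ (agree⁺ n)
    fibonacci-unique -[1+ n ] = proj₁ (agree⁻ (suc n))

  -- Both sides are generalized Fibonacci sequences in b, equal at b = 0 and b = 1.
  fibonacci-symmetric-sum : ∀ {H} → IsGeneralizedFibonacci H → ∀ m b →
    H (m ℤ.+ b) + [-1]^ b * H (m ℤ.- b) ≈ fromℤ (L b) * H m
  fibonacci-symmetric-sum {H} H-fib m = fibonacci-unique sum-fib lucas-fib sum₀ sum₁
    where
    -- As b grows, H (m - b) runs backwards and so obeys the recurrence with one sign reversed; the
    -- alternating factor (-1)^b undoes that reversal.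
    sum-fib : IsGeneralizedFibonacci (λ b → H (m ℤ.+ b) + [-1]^ b * H (m ℤ.- b))
    sum-fib b = begin
      H (m ℤ.+ (b ℤ.+ + 2)) + [-1]^ (b ℤ.+ + 2) * y  ≈⟨ +-cong upper (*-congʳ [-1]^-suc-suc) ⟩
      u + v + - - e * y                              ≈⟨ solve 5 (λ u v e y z → u :+ v :+ (:- (:- e)) :* y := u :+ (:- e) :* z :+ (v :+ e :* (z :+ y))) refl u v e y z ⟩
      u + - e * z + (v + e * (z + y))                ≈⟨ +-cong (+-congˡ (*-congʳ ([-1]^-suc b))) (+-congˡ (*-congˡ lower)) ⟨
      u + [-1]^ (b ℤ.+ + 1) * z + (v + e * H (m ℤ.- b)) ∎
      where
      u = H (m ℤ.+ (b ℤ.+ + 1))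
      v = H (m ℤ.+ b)
      e = [-1]^ b
      y = H (m ℤ.- (b ℤ.+ + 2))
      z = H (m ℤ.- (b ℤ.+ + 1))
      upper : H (m ℤ.+ (b ℤ.+ + 2)) ≈ u + v
      upper = ≡.subst₂ (λ i j → H i ≈ H j + v) (ℤ.+-assoc m b (+ 2)) (ℤ.+-assoc m b (+ 1)) (H-fib (m ℤ.+ b))
      lower : H (m ℤ.- b) ≈ z + y
      lower = ≡.subst₂ (λ i j → H i ≈ H j + y) (i≡ m b) (j≡ m b) (H-fib (m ℤ.- (b ℤ.+ + 2)))
        where
        i≡ : ∀ m b → m ℤ.- (b ℤ.+ + 2) ℤ.+ + 2 ≡ m ℤ.- b
        i≡ = solve-∀
        j≡ : ∀ m b → m ℤ.- (b ℤ.+ + 2) ℤ.+ + 1 ≡ m ℤ.- (b ℤ.+ + 1)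
        j≡ = solve-∀
      [-1]^-suc-suc : [-1]^ (b ℤ.+ + 2) ≈ - - e
      [-1]^-suc-suc = begin
        [-1]^ (b ℤ.+ + 2)          ≡⟨ ≡.cong [-1]^ (ℤ.+-assoc b (+ 1) (+ 1)) ⟨
        [-1]^ (b ℤ.+ + 1 ℤ.+ + 1)  ≈⟨ [-1]^-suc (b ℤ.+ + 1) ⟩
        - [-1]^ (b ℤ.+ + 1)        ≈⟨ -‿cong ([-1]^-suc b) ⟩
        - - e                      ∎

    lucas-fib : IsGeneralizedFibonacci (λ b → fromℤ (L b) * H m)
    lucas-fib b = begin
      fromℤ (L (b ℤ.+ + 2)) * H m                        ≡⟨ ≡.cong (λ i → fromℤ i * H m) (L-recurrence b) ⟩
      fromℤ (L (b ℤ.+ + 1) ℤ.+ L b) * H m                ≈⟨ *-congʳ (fromℤ-homo-+ (L (b ℤ.+ + 1)) (L b)) ⟩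
      (fromℤ (L (b ℤ.+ + 1)) + fromℤ (L b)) * H m        ≈⟨ distribʳ (H m) _ _ ⟩
      fromℤ (L (b ℤ.+ + 1)) * H m + fromℤ (L b) * H m    ∎

    sum₀ : H (m ℤ.+ + 0) + 1# * H (m ℤ.- + 0) ≈ ι 2 * H m
    sum₀ = begin
      -- Here m - 0 computes to m + 0, so one index equation rewrites both terms. The seed 2 of the
      -- Lucas numbers counts the two copies of H m.
      H (m ℤ.+ + 0) + 1# * H (m ℤ.+ + 0)  ≡⟨ ≡.cong (λ i → H i + 1# * H i) (ℤ.+-identityʳ m) ⟩
      H m + 1# * H m                      ≈⟨ solve 1 (λ h → h :+ :1 :* h := :ι 2 :* h) refl (H m) ⟩
      ι 2 * H m                           ∎

    sum₁ : H (m ℤ.+ + 1) + - 1# * 1# * H (m ℤ.- + 1) ≈ ι 1 * H m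
    sum₁ = begin
      -- Splitting H (m + 1) by the recurrence produces an H (m - 1) that the sign (-1)^1 cancels,
      -- leaving one H m, in accordance with the seed 1.
      H (m ℤ.+ + 1) + - 1# * 1# * H (m ℤ.- + 1)              ≈⟨ +-congʳ (≡.subst₂ (λ i j → H i ≈ H j + H (m ℤ.- + 1)) (i≡ m) (j≡ m) (H-fib (m ℤ.- + 1))) ⟩
      H m + H (m ℤ.- + 1) + - 1# * 1# * H (m ℤ.- + 1)        ≈⟨ solve 2 (λ h k → h :+ k :+ :- :1 :* :1 :* k := :ι 1 :* h) refl (H m) (H (m ℤ.- + 1)) ⟩
      ι 1 * H m                                              ∎
      where
      i≡ : ∀ m → m ℤ.- + 1 ℤ.+ + 2 ≡ m ℤ.+ + 1
      i≡ = solve-∀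
      j≡ : ∀ m → m ℤ.- + 1 ℤ.+ + 1 ≡ m
      j≡ = solve-∀

  -- Pascal's rule for binomial sums.

  binomialSum : ℕ → (ℕ → Carrier) → Carrier
  binomialSum v t = ∑[ k ≤ v ] (ι (v C toℕ k) * t (toℕ k))

  -- The k = 0 term is set aside and Pascal's rule splits every other coefficient. Leaving `t`
  -- arbitrary keeps this apart from the signs and index arithmetic of `P`.
  binomialSum-suc : ∀ v t → binomialSum (suc v) t ≈ binomialSum v t + binomialSum v (t ∘ suc)
  binomialSum-suc v t = begin
    ι 1 * t 0 + ∑[ k ≤ v ] (ι (suc v C suc (toℕ k)) * t (suc (toℕ k)))
      ≈⟨ +-congˡ (sum-cong-≋ {suc v} (λ k → pascal (toℕ k))) ⟩
    ι 1 * t 0 + ∑[ k ≤ v ] (ι (v C suc (toℕ k)) * t (suc (toℕ k)) + ι (v C toℕ k) * t (suc (toℕ k)))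
      ≈⟨ +-congˡ (∑-distrib-+ {suc v} (λ k → ι (v C suc (toℕ k)) * t (suc (toℕ k))) (λ k → ι (v C toℕ k) * t (suc (toℕ k)))) ⟩
    ι 1 * t 0 + (∑[ k ≤ v ] (ι (v C suc (toℕ k)) * t (suc (toℕ k))) + binomialSum v (t ∘ suc))
      ≈⟨ +-assoc _ _ _ ⟨
    -- Since v C 0 is 1, the detached term rejoins the first sum as its k = 0 term. That sum now
    -- reaches k = v + 1, where v C (v + 1) = 0.
    ∑[ k ≤ suc v ] (ι (v C toℕ k) * t (toℕ k)) + binomialSum v (t ∘ suc)
      ≈⟨ +-congʳ drop-last ⟩
    binomialSum v t + binomialSum v (t ∘ suc) ∎
    where
    pascal : ∀ k → ι (suc v C suc k) * t (suc k) ≈ ι (v C suc k) * t (suc k) + ι (v C k) * t (suc k)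
    pascal k = begin
      ι (suc v C suc k) * t (suc k)                      ≡⟨ ≡.cong (λ i → ι i * t (suc k)) (nCk+nC[k+1]≡[n+1]C[k+1] v k) ⟨
      ι (v C k ℕ.+ v C suc k) * t (suc k)                ≈⟨ *-congʳ (ι-homo-+ (v C k) (v C suc k)) ⟩
      (ι (v C k) + ι (v C suc k)) * t (suc k)            ≈⟨ solve 3 (λ p q s → (p :+ q) :* s := q :* s :+ p :* s) refl (ι (v C k)) (ι (v C suc k)) (t (suc k)) ⟩
      ι (v C suc k) * t (suc k) + ι (v C k) * t (suc k)  ∎

    f : ℕ → Carrier
    f k = ι (v C k) * t k

    last≈0 : f (toℕ (fromℕ (suc v))) ≈ 0#
    last≈0 = begin
      f (toℕ (fromℕ (suc v)))      ≡⟨ ≡.cong f (toℕ-fromℕ (suc v)) ⟩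
      ι (v C suc v) * t (suc v)    ≡⟨ ≡.cong (λ i → ι i * t (suc v)) (k>n⇒nCk≡0 (ℕ.n<1+n v)) ⟩
      0# * t (suc v)               ≈⟨ zeroˡ _ ⟩
      0#                           ∎

    drop-last : ∑[ k ≤ suc v ] f (toℕ k) ≈ binomialSum v t
    drop-last = begin
      ∑[ k ≤ suc v ] f (toℕ k)                                    ≈⟨ sum-init-last {suc v} (f ∘ toℕ) ⟩
      ∑[ k ≤ v ] f (toℕ (inject₁ k)) + f (toℕ (fromℕ (suc v)))    ≈⟨ +-cong (sum-cong-≋ {suc v} (λ k → reflexive (≡.cong f (toℕ-inject₁ k)))) last≈0 ⟩
      binomialSum v t + 0#                                        ≈⟨ +-identityʳ _ ⟩
      binomialSum v t                                             ∎

  -- The sequences `Q v` and the action of Δ on them.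

  module _ (G : ℤ → Carrier) (b : ℤ) (x : Carrier) where

    -- P G a b x v w is Q v (a + b w).
    Q : ℕ → ℤ → Carrier
    Q v m = ∑[ k ≤ v ] ( ι (v C toℕ k) * [-1]^ ((b ℤ.+ + 1) ℤ.* + toℕ k) * x ^ toℕ k
                         * G (m ℤ.- b ℤ.* + toℕ k) )

    private
      -- This is (-1)^(b+1) x, so the sign and the power of x in the k-th term merge into `s ^ k`.
      s : Carrier
      s = - [-1]^ b * x

      t : ℤ → ℕ → Carrier
      t m k = s ^ k * G (m ℤ.- b ℤ.* + k)

    Q≈binomialSum : ∀ v m → Q v m ≈ binomialSum v (t m)
    Q≈binomialSum v m = sum-cong-≋ {suc v} (λ k → term (toℕ k))
      where
      coefficient : ∀ k → [-1]^ ((b ℤ.+ + 1) ℤ.* + k) * x ^ k ≈ s ^ k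
      coefficient zero    = trans (*-congʳ (reflexive (≡.cong [-1]^ (ℤ.*-zeroʳ (b ℤ.+ + 1))))) (*-identityˡ 1#)
      coefficient (suc k) = begin
        -- The exponent of -1 is an absolute value, which is multiplicative; hence it splits as a
        -- sum of naturals even when b + 1 is negative.
        [-1]^ ((b ℤ.+ + 1) ℤ.* + suc k) * (x * x ^ k)                 ≡⟨ ≡.cong (λ i → (- 1#) ^ i * (x * x ^ k)) (ℤ.abs-* (b ℤ.+ + 1) (+ suc k)) ⟩
        (- 1#) ^ (ℤ.∣ b ℤ.+ + 1 ∣ ℕ.* suc k) * (x * x ^ k)            ≡⟨ ≡.cong (λ i → (- 1#) ^ i * (x * x ^ k)) (ℕ.*-suc ℤ.∣ b ℤ.+ + 1 ∣ k) ⟩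
        (- 1#) ^ (ℤ.∣ b ℤ.+ + 1 ∣ ℕ.+ ℤ.∣ b ℤ.+ + 1 ∣ ℕ.* k) * (x * x ^ k)  ≈⟨ *-congʳ (^-homo-* (- 1#) ℤ.∣ b ℤ.+ + 1 ∣ _) ⟩
        [-1]^ (b ℤ.+ + 1) * (- 1#) ^ (ℤ.∣ b ℤ.+ + 1 ∣ ℕ.* k) * (x * x ^ k)   ≡⟨ ≡.cong (λ i → [-1]^ (b ℤ.+ + 1) * (- 1#) ^ i * (x * x ^ k)) (ℤ.abs-* (b ℤ.+ + 1) (+ k)) ⟨
        [-1]^ (b ℤ.+ + 1) * [-1]^ ((b ℤ.+ + 1) ℤ.* + k) * (x * x ^ k)  ≈⟨ *-congʳ (*-congʳ ([-1]^-suc b)) ⟩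
        - [-1]^ b * [-1]^ ((b ℤ.+ + 1) ℤ.* + k) * (x * x ^ k)          ≈⟨ solve 4 (λ e f x y → (:- e) :* f :* (x :* y) := (:- e) :* x :* (f :* y)) refl ([-1]^ b) ([-1]^ ((b ℤ.+ + 1) ℤ.* + k)) x (x ^ k) ⟩
        s * ([-1]^ ((b ℤ.+ + 1) ℤ.* + k) * x ^ k)                      ≈⟨ *-congˡ (coefficient k) ⟩
        s * s ^ k                                                      ∎

      term : ∀ k → ι (v C k) * [-1]^ ((b ℤ.+ + 1) ℤ.* + k) * x ^ k * G (m ℤ.- b ℤ.* + k) ≈ ι (v C k) * t m k
      term k = begin
        ι (v C k) * [-1]^ ((b ℤ.+ + 1) ℤ.* + k) * x ^ k * g    ≈⟨ *-congʳ (*-assoc (ι (v C k)) _ _) ⟩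
        ι (v C k) * ([-1]^ ((b ℤ.+ + 1) ℤ.* + k) * x ^ k) * g  ≈⟨ *-congʳ (*-congˡ (coefficient k)) ⟩
        ι (v C k) * s ^ k * g                                  ≈⟨ *-assoc _ _ _ ⟩
        ι (v C k) * t m k                                      ∎
        where g = G (m ℤ.- b ℤ.* + k)

    Q-zero : ∀ m → Q 0 m ≈ G m
    Q-zero m = begin
      Q 0 m                                    ≈⟨ Q≈binomialSum 0 m ⟩
      ι 1 * (1# * G (m ℤ.- b ℤ.* + 0)) + 0#    ≡⟨ ≡.cong (λ i → ι 1 * (1# * G i) + 0#) (i≡ m b) ⟩
      ι 1 * (1# * G m) + 0#                    ≈⟨ solve 1 (λ g → :ι 1 :* (:1 :* g) :+ :ι 0 := g) refl (G m) ⟩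
      G m                                      ∎
      where
      i≡ : ∀ m b → m ℤ.- b ℤ.* + 0 ≡ m
      i≡ = solve-∀

    -- Raising k by one lowers the argument of `G` by b and costs one factor `s`, so the second half
    -- of Pascal's split is `s` times the sum at m - b.
    Q-suc : ∀ v m → Q (suc v) m ≈ Q v m + - [-1]^ b * x * Q v (m ℤ.- b)
    Q-suc v m = begin
      Q (suc v) m                                            ≈⟨ Q≈binomialSum (suc v) m ⟩
      binomialSum (suc v) (t m)                              ≈⟨ binomialSum-suc v (t m) ⟩
      binomialSum v (t m) + binomialSum v (t m ∘ suc)        ≈⟨ +-congˡ (sum-cong-≋ {suc v} (λ k → shift (toℕ k))) ⟩
      binomialSum v (t m) + ∑[ k ≤ v ] (s * (ι (v C toℕ k) * t (m ℤ.- b) (toℕ k)))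
                                                             ≈⟨ +-congˡ (*-distribˡ-sum {suc v} s (λ k → ι (v C toℕ k) * t (m ℤ.- b) (toℕ k))) ⟨
      binomialSum v (t m) + s * binomialSum v (t (m ℤ.- b))  ≈⟨ +-cong (Q≈binomialSum v m) (*-congˡ (Q≈binomialSum v (m ℤ.- b))) ⟨
      Q v m + s * Q v (m ℤ.- b)                              ∎
      where
      i≡ : ∀ m b k → m ℤ.- b ℤ.* (+ 1 ℤ.+ k) ≡ m ℤ.- b ℤ.- b ℤ.* k
      i≡ = solve-∀
      shift : ∀ k → ι (v C k) * t m (suc k) ≈ s * (ι (v C k) * t (m ℤ.- b) k)
      shift k = begin
        ι (v C k) * (s * s ^ k * G (m ℤ.- b ℤ.* + suc k))  ≡⟨ ≡.cong (λ i → ι (v C k) * (s * s ^ k * G i)) (i≡ m b (+ k)) ⟩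
        ι (v C k) * (s * s ^ k * g)                        ≈⟨ solve 4 (λ i s y g → i :* (s :* y :* g) := s :* (i :* (y :* g))) refl (ι (v C k)) s (s ^ k) g ⟩
        s * (ι (v C k) * (s ^ k * g))                      ∎
        where g = G (m ℤ.- b ℤ.- b ℤ.* + k)

    module _ (G-fib : IsGeneralizedFibonacci G) where

      -- The recurrence is linear and invariant under shifts, and `Q-suc` builds each `Q (suc v)` as
      -- a combination of two shifts of `Q v`.
      Q-fib : ∀ v → IsGeneralizedFibonacci (Q v)
      Q-fib zero    m = begin
        Q 0 (m ℤ.+ + 2)            ≈⟨ Q-zero (m ℤ.+ + 2) ⟩
        G (m ℤ.+ + 2)              ≈⟨ G-fib m ⟩
        G (m ℤ.+ + 1) + G m        ≈⟨ +-cong (Q-zero (m ℤ.+ + 1)) (Q-zero m) ⟨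
        Q 0 (m ℤ.+ + 1) + Q 0 m    ∎
      Q-fib (suc v) m = begin
        Q (suc v) (m ℤ.+ + 2)                                    ≈⟨ Q-suc v (m ℤ.+ + 2) ⟩
        Q v (m ℤ.+ + 2) + s * Q v (m ℤ.+ + 2 ℤ.- b)              ≡⟨ ≡.cong (λ i → Q v (m ℤ.+ + 2) + s * Q v i) (i≡ m b (+ 2)) ⟩
        Q v (m ℤ.+ + 2) + s * Q v (m ℤ.- b ℤ.+ + 2)              ≈⟨ +-cong (Q-fib v m) (*-congˡ (Q-fib v (m ℤ.- b))) ⟩
        Q v (m ℤ.+ + 1) + Q v m + s * (Q v (m ℤ.- b ℤ.+ + 1) + Q v (m ℤ.- b))
          ≈⟨ solve 5 (λ p q s y z → p :+ q :+ s :* (y :+ z) := p :+ s :* y :+ (q :+ s :* z)) refl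
               (Q v (m ℤ.+ + 1)) (Q v m) s (Q v (m ℤ.- b ℤ.+ + 1)) (Q v (m ℤ.- b)) ⟩
        Q v (m ℤ.+ + 1) + s * Q v (m ℤ.- b ℤ.+ + 1) + (Q v m + s * Q v (m ℤ.- b))
          ≡⟨ ≡.cong (λ i → Q v (m ℤ.+ + 1) + s * Q v i + (Q v m + s * Q v (m ℤ.- b))) (i≡ m b (+ 1)) ⟨
        Q v (m ℤ.+ + 1) + s * Q v (m ℤ.+ + 1 ℤ.- b) + (Q v m + s * Q v (m ℤ.- b))
          ≈⟨ +-cong (Q-suc v (m ℤ.+ + 1)) (Q-suc v m) ⟨
        Q (suc v) (m ℤ.+ + 1) + Q (suc v) m                      ∎
        where
        i≡ : ∀ m b k → m ℤ.+ k ℤ.- b ≡ m ℤ.- b ℤ.+ k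
        i≡ = solve-∀

      -- With T the shift by b and e = (-1)^b, one has (1 - xT)(1 - exT^(-1)) = 1 - x(T + eT^(-1)) +
      -- ex^2. On a generalized Fibonacci sequence T + eT^(-1) acts as L_b, so the product acts as
      -- Δ; its second factor is the passage from `Q v` to `Q (suc v)`.
      Δ*Q : ∀ v m → (1# - fromℤ (L b) * x + [-1]^ b * x ^ 2) * Q v m ≈ Q (suc v) m - x * Q (suc v) (m ℤ.+ b)
      Δ*Q v m = begin
        (1# - l * x + e * x ^ 2) * q₀
          ≈⟨ solve 4 (λ l x e q → (:1 :- l :* x :+ e :* x :^ 2) :* q := q :- x :* (l :* q) :+ e :* x :* x :* q) refl l x e q₀ ⟩
        q₀ - x * (l * q₀) + e * x * x * q₀
          ≈⟨ +-congʳ (+-congˡ (-‿cong (*-congˡ (fibonacci-symmetric-sum (Q-fib v) m b)))) ⟨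
        q₀ - x * (q₊ + e * q₋) + e * x * x * q₀
          ≈⟨ solve 5 (λ x e q₀ q₊ q₋ → q₀ :- x :* (q₊ :+ e :* q₋) :+ e :* x :* x :* q₀ := q₀ :+ (:- e) :* x :* q₋ :- x :* (q₊ :+ (:- e) :* x :* q₀)) refl x e q₀ q₊ q₋ ⟩
        q₀ + - e * x * q₋ - x * (q₊ + - e * x * q₀)
          -- The term in x^2 belongs to `Q (suc v) (m + b)`, whose shifted half sits at m + b - b =
          -- m.
          ≡⟨ ≡.cong (λ i → q₀ + - e * x * q₋ - x * (q₊ + - e * x * Q v i)) (i≡ m b) ⟨
        q₀ + - e * x * q₋ - x * (q₊ + - e * x * Q v (m ℤ.+ b ℤ.- b))
          ≈⟨ +-cong (Q-suc v m) (-‿cong (*-congˡ (Q-suc v (m ℤ.+ b)))) ⟨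
        Q (suc v) m - x * Q (suc v) (m ℤ.+ b) ∎
        where
        l  = fromℤ (L b)
        e  = [-1]^ b
        q₀ = Q v m
        q₊ = Q v (m ℤ.+ b)
        q₋ = Q v (m ℤ.- b)
        i≡ : ∀ m b → m ℤ.+ b ℤ.- b ≡ m
        i≡ = solve-∀

  -- Summation by parts and the forward differences of the fourth power.

  summation-by-parts : ∀ {d} {f g r r′ : ℕ → Carrier} →
    (∀ k → f (suc k) ≈ f k + g k) → (∀ k → r k ≈ d * (r′ k - r′ (suc k))) → ∀ n →
    ∑[ k ≤ n ] (f (toℕ k) * r (toℕ k))
      ≈ d * (f 0 * r′ 0 - f (suc n) * r′ (suc n) + ∑[ k ≤ n ] (g (toℕ k) * r′ (suc (toℕ k))))
  summation-by-parts {d} {f} {g} {r} {r′} f-suc r≈ zero    = begin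
    f 0 * r 0 + 0#                                         ≈⟨ +-congʳ (*-congˡ (r≈ 0)) ⟩
    f 0 * (d * (r′ 0 - r′ 1)) + 0#                         ≈⟨ solve 5 (λ f g d y z → f :* (d :* (y :- z)) :+ :ι 0 := d :* (f :* y :- (f :+ g) :* z :+ (g :* z :+ :ι 0))) refl (f 0) (g 0) d (r′ 0) (r′ 1) ⟩
    d * (f 0 * r′ 0 - (f 0 + g 0) * r′ 1 + (g 0 * r′ 1 + 0#))  ≈⟨ *-congˡ (+-congʳ (+-congˡ (-‿cong (*-congʳ (f-suc 0))))) ⟨
    d * (f 0 * r′ 0 - f 1 * r′ 1 + (g 0 * r′ 1 + 0#))      ∎
  summation-by-parts {d} {f} {g} {r} {r′} f-suc r≈ (suc n) = begin
    f 0 * r 0 + ∑[ k ≤ n ] (f (suc (toℕ k)) * r (suc (toℕ k)))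
      -- The sum is peeled at its first term, so the induction hypothesis is taken for the tails of
      -- all four sequences.
      ≈⟨ +-cong (*-congˡ (r≈ 0)) (summation-by-parts (f-suc ∘ suc) (r≈ ∘ suc) n) ⟩
    f 0 * (d * (r′ 0 - r′ 1)) + d * (f 1 * r′ 1 - z + T)
      -- The lower boundary term of the tail is opened as f 0 + g 0: the part with f 0 cancels
      -- against the peeled term, and the part with g 0 becomes the first term of the new sum.
      ≈⟨ +-congˡ (*-congˡ (+-congʳ (+-congʳ (*-congʳ (f-suc 0))))) ⟩
    f 0 * (d * (r′ 0 - r′ 1)) + d * ((f 0 + g 0) * r′ 1 - z + T)
      ≈⟨ solve 7 (λ f g d r₀ r₁ z T → f :* (d :* (r₀ :- r₁)) :+ d :* ((f :+ g) :* r₁ :- z :+ T) := d :* (f :* r₀ :- z :+ (g :* r₁ :+ T)))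
           refl (f 0) (g 0) d (r′ 0) (r′ 1) z T ⟩
    d * (f 0 * r′ 0 - z + (g 0 * r′ 1 + T)) ∎
    where
    z = f (suc (suc n)) * r′ (suc (suc n))
    T = ∑[ k ≤ n ] (g (suc (toℕ k)) * r′ (suc (suc (toℕ k))))

  -- The successive forward differences of ν ↦ ν⁴.
  :δ : ∀ {k} → ℕ → Polynomial k → Polynomial k
  :δ 0 ν = ν :^ 4
  :δ 1 ν = :ι 4 :* ν :^ 3 :+ :ι 6 :* ν :^ 2 :+ :ι 4 :* ν :+ :ι 1
  :δ 2 ν = :ι 12 :* ν :^ 2 :+ :ι 24 :* ν :+ :ι 14
  :δ 3 ν = :ι 24 :* ν :+ :ι 36
  :δ 4 ν = :ι 24
  :δ _ ν = :ι 0

  -- Evaluating the solver polynomials makes statements about `δ` literal instances of solver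
  -- equations in `:δ`.
  δ : ℕ → ℕ → Carrier
  δ j k = ⟦ :δ j (var 0F) ⟧ (ι k ∷ [])

  δ-suc : ∀ j k → δ j (suc k) ≈ δ j k + δ (suc j) k
  -- `ι (suc k)` computes to 1# + `ι k`, which is the value of `:1 :+ ν`.
  δ-suc 0 k = solve 1 (λ ν → :δ 0 (:1 :+ ν) := :δ 0 ν :+ :δ 1 ν) refl (ι k)
  δ-suc 1 k = solve 1 (λ ν → :δ 1 (:1 :+ ν) := :δ 1 ν :+ :δ 2 ν) refl (ι k)
  δ-suc 2 k = solve 1 (λ ν → :δ 2 (:1 :+ ν) := :δ 2 ν :+ :δ 3 ν) refl (ι k)
  δ-suc 3 k = solve 1 (λ ν → :δ 3 (:1 :+ ν) := :δ 3 ν :+ :δ 4 ν) refl (ι k)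
  δ-suc 4 k = sym (+-identityʳ (ι 24))
  δ-suc (suc (suc (suc (suc (suc j))))) k = sym (+-identityʳ 0#)

  -- Five summations by parts against x^w P(v,w).

  module _ (G : ℤ → Carrier) (G-fib : IsGeneralizedFibonacci G) (a b : ℤ) (x : Carrier)
           (Δ#0 : (1# - fromℤ (L b) * x + [-1]^ b * x ^ 2) # 0#) where

    private
      Δ d : Carrier
      Δ = 1# - fromℤ (L b) * x + [-1]^ b * x ^ 2
      d = inverse Δ#0

      p : ℕ → ℕ → Carrier
      p = P G a b x

    inverse-* : d * Δ ≈ 1#
    inverse-* = begin
      d * Δ         ≈⟨ *-congˡ (trans (+-congˡ -0#≈0#) (+-identityʳ Δ)) ⟨
      d * (Δ - 0#)  ≈⟨ proj₁ (proj₂ (#⇒invertible Δ#0)) ⟩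
      1#            ∎

    W : ℕ → ℕ → Carrier
    W v w = x ^ w * p v w

    W-telescopes : ∀ v w → W v w ≈ d * (W (suc v) w - W (suc v) (suc w))
    W-telescopes v w = begin
      y * q                                     ≈⟨ *-identityˡ _ ⟨
      1# * (y * q)                              ≈⟨ *-congʳ inverse-* ⟨
      d * Δ * (y * q)                           ≈⟨ solve 4 (λ d Δ y q → d :* Δ :* (y :* q) := d :* (y :* (Δ :* q))) refl d Δ y q ⟩
      d * (y * (Δ * q))                         ≈⟨ *-congˡ (*-congˡ (Δ*Q G b x G-fib v m)) ⟩
      -- Shifting the argument by b is the same as raising w by one; the accompanying factor x
      -- raises x^w to x^(w+1).
      d * (y * (q₀ - x * Q G b x (suc v) (m ℤ.+ b)))  ≡⟨ ≡.cong (λ i → d * (y * (q₀ - x * Q G b x (suc v) i))) (i≡ a b (+ w)) ⟩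
      d * (y * (q₀ - x * q₁))                   ≈⟨ solve 5 (λ d y q₀ x q₁ → d :* (y :* (q₀ :- x :* q₁)) := d :* (y :* q₀ :- x :* y :* q₁)) refl d y q₀ x q₁ ⟩
      d * (y * q₀ - x * y * q₁)                 ∎
      where
      m  = a ℤ.+ b ℤ.* + w
      y  = x ^ w
      q  = p v w
      q₀ = p (suc v) w
      q₁ = p (suc v) (suc w)
      i≡ : ∀ a b w → a ℤ.+ b ℤ.* w ℤ.+ b ≡ a ℤ.+ b ℤ.* (+ 1 ℤ.+ w)
      i≡ = solve-∀

    -- The sum left after j summations by parts. Each of them moves the argument of `W` one step
    -- ahead of k, hence the offset j.
    S : ℕ → ℕ → Carrier
    S j n = ∑[ k ≤ n ] (δ j (toℕ k) * W j (toℕ k ℕ.+ j))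

    S-step : ∀ j n → S j n ≈ d * (δ j 0 * W (suc j) j - δ j (suc n) * W (suc j) (n ℕ.+ suc j) + S (suc j) n)
    S-step j n = begin
      S j n
        ≈⟨ summation-by-parts {d} {δ j} {δ (suc j)} {λ k → W j (k ℕ.+ j)} {λ k → W (suc j) (k ℕ.+ j)}
             (δ-suc j) (λ k → W-telescopes j (k ℕ.+ j)) n ⟩
      d * (δ j 0 * W (suc j) j - δ j (suc n) * W (suc j) (suc n ℕ.+ j)
            + ∑[ k ≤ n ] (δ (suc j) (toℕ k) * W (suc j) (suc (toℕ k) ℕ.+ j)))
        -- Moving the successor onto j gives the offset of `S (suc j)` and the exponents n + 1 to n
        -- + 5 of the final formula.
        ≈⟨ *-congˡ (+-cong
             (+-congˡ (-‿cong (reflexive (≡.cong (λ i → δ j (suc n) * W (suc j) i) (ℕ.+-suc n j)))))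
             (sum-cong-≋ {suc n} (λ k → reflexive (≡.cong (λ i → δ (suc j) (toℕ k) * W (suc j) i) (ℕ.+-suc (toℕ k) j))))) ⟨
      d * (δ j 0 * W (suc j) j - δ j (suc n) * W (suc j) (n ℕ.+ suc j) + S (suc j) n) ∎

    -- The fifth difference of a quartic vanishes, so the process stops here.
    S₅≈0 : ∀ n → S 5 n ≈ 0#
    S₅≈0 n = trans (sum-cong-≋ {suc n} (λ k → zeroˡ (W 5 (toℕ k ℕ.+ 5)))) (sum-replicate-zero (suc n))

    S₀≈ : ∀ n → ∑[ k ≤ n ] (x ^ toℕ k * ι (toℕ k) ^ 4 * G (a ℤ.+ b ℤ.* + toℕ k)) ≈ S 0 n
    S₀≈ n = sum-cong-≋ {suc n} (λ k → term (toℕ k))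
      where
      term : ∀ k → x ^ k * ι k ^ 4 * G (a ℤ.+ b ℤ.* + k) ≈ δ 0 k * W 0 (k ℕ.+ 0)
      term k = begin
        x ^ k * ι k ^ 4 * G (a ℤ.+ b ℤ.* + k)    ≈⟨ *-congˡ (Q-zero G b x (a ℤ.+ b ℤ.* + k)) ⟨
        x ^ k * ι k ^ 4 * p 0 k                  ≈⟨ solve 3 (λ y i q → y :* i :* q := i :* (y :* q)) refl (x ^ k) (ι k ^ 4) (p 0 k) ⟩
        δ 0 k * W 0 k                            ≡⟨ ≡.cong (λ i → δ 0 k * W 0 i) (ℕ.+-identityʳ k) ⟨
        δ 0 k * W 0 (k ℕ.+ 0)                    ∎

    S₀-closed : ∀ n → let boundary = λ j → δ j (suc n) * W (suc j) (n ℕ.+ suc j) - δ j 0 * W (suc j) j in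
      S 0 n ≈ - (d * boundary 0) - d ^ 2 * boundary 1 - d ^ 3 * boundary 2 - d ^ 4 * boundary 3 - d ^ 5 * boundary 4
    S₀-closed n = begin
      S 0 n
        ≈⟨ S-step 0 n ⟩
      d * (l 0 - u 0 + S 1 n)
        ≈⟨ *-congˡ (+-congˡ (S-step 1 n)) ⟩
      d * (l 0 - u 0 + d * (l 1 - u 1 + S 2 n))
        ≈⟨ *-congˡ (+-congˡ (*-congˡ (+-congˡ (S-step 2 n)))) ⟩
      d * (l 0 - u 0 + d * (l 1 - u 1 + d * (l 2 - u 2 + S 3 n)))
        ≈⟨ *-congˡ (+-congˡ (*-congˡ (+-congˡ (*-congˡ (+-congˡ (S-step 3 n)))))) ⟩
      d * (l 0 - u 0 + d * (l 1 - u 1 + d * (l 2 - u 2 + d * (l 3 - u 3 + S 4 n))))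
        ≈⟨ *-congˡ (+-congˡ (*-congˡ (+-congˡ (*-congˡ (+-congˡ (*-congˡ (+-congˡ (trans (S-step 4 n) (*-congˡ (+-congˡ (S₅≈0 n))))))))))) ⟩
      d * (l 0 - u 0 + d * (l 1 - u 1 + d * (l 2 - u 2 + d * (l 3 - u 3 + d * (l 4 - u 4 + 0#)))))
        -- Unnesting gives boundary j the factor d^(j+1); each difference is negated so that the
        -- upper boundary comes first.
        ≈⟨ solve 11 (λ d l₀ l₁ l₂ l₃ l₄ u₀ u₁ u₂ u₃ u₄ →
             d :* (l₀ :- u₀ :+ d :* (l₁ :- u₁ :+ d :* (l₂ :- u₂ :+ d :* (l₃ :- u₃ :+ d :* (l₄ :- u₄ :+ :ι 0))))) :=
             :- (d :* (u₀ :- l₀)) :- d :^ 2 :* (u₁ :- l₁) :- d :^ 3 :* (u₂ :- l₂) :- d :^ 4 :* (u₃ :- l₃) :- d :^ 5 :* (u₄ :- l₄))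
             refl d (l 0) (l 1) (l 2) (l 3) (l 4) (u 0) (u 1) (u 2) (u 3) (u 4) ⟩
      - (d * (u 0 - l 0)) - d ^ 2 * (u 1 - l 1) - d ^ 3 * (u 2 - l 2) - d ^ 4 * (u 3 - l 3) - d ^ 5 * (u 4 - l 4) ∎
      where
      l u : ℕ → Carrier
      l j = δ j 0 * W (suc j) j
      u j = δ j (suc n) * W (suc j) (n ℕ.+ suc j)

-- Matching the boundary terms with the explicit coefficients.

mainTheorem5 : ∀ {c ℓ₁ ℓ₂} (K : HeytingField c ℓ₁ ℓ₂) →
  let open HeytingField K
      open GeneralizedFibonacci K
  in
  (G : ℤ → Carrier) → IsGeneralizedFibonacci G →
  (a b : ℤ) (n : ℕ) (x : Carrier) →
  let Δ = 1# - fromℤ (L b) * x + [-1]^ b * x ^ 2 in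
  (Δ#0 : Δ # 0#) →
  let 1/Δ = inverse Δ#0
      p   = P G a b x
      ν   = ι n
  in
  ∑[ k ≤ n ] (x ^ toℕ k * ι (toℕ k) ^ 4 * G (a ℤ.+ b ℤ.* + toℕ k))
    ≈ - (1/Δ * ((ν + 1#) ^ 4 * x ^ (n ℕ.+ 1) * p 1 (n ℕ.+ 1)))
      - 1/Δ ^ 2 * ((ι 4 * ν ^ 3 + ι 18 * ν ^ 2 + ι 28 * ν + ι 15) * x ^ (n ℕ.+ 2) * p 2 (n ℕ.+ 2) - x * p 2 1)
      - ι 2 * 1/Δ ^ 3 * ((ι 6 * ν ^ 2 + ι 24 * ν + ι 25) * x ^ (n ℕ.+ 3) * p 3 (n ℕ.+ 3) - ι 7 * x ^ 2 * p 3 2)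
      - ι 12 * 1/Δ ^ 4 * ((ι 2 * ν + ι 5) * x ^ (n ℕ.+ 4) * p 4 (n ℕ.+ 4) - ι 3 * x ^ 3 * p 4 3)
      - ι 24 * 1/Δ ^ 5 * (x ^ (n ℕ.+ 5) * p 5 (n ℕ.+ 5) - x ^ 4 * p 5 4)
mainTheorem5 K G G-fib a b n x Δ#0 = begin
  ∑[ k ≤ n ] (x ^ toℕ k * ι (toℕ k) ^ 4 * G (a ℤ.+ b ℤ.* + toℕ k))
    ≈⟨ S₀≈ G G-fib a b x Δ#0 n ⟩
  S G G-fib a b x Δ#0 0 n
    ≈⟨ S₀-closed G G-fib a b x Δ#0 n ⟩
  _
    ≈⟨ +-cong (+-cong (+-cong (+-cong (-‿cong term₁) (-‿cong term₂)) (-‿cong term₃)) (-‿cong term₄)) (-‿cong term₅) ⟩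
  _ ∎
  where
  open HeytingField K
  open GeneralizedFibonacci K
  open FibonacciSums K
  open import Relation.Binary.Reasoning.Setoid setoid
  d = inverse Δ#0
  p = P G a b x
  ν = ι n
  -- The fourth power vanishes at 0, so the first boundary has no lower term.
  term₁ = solve 5 (λ d ν y q r →
      d :* (:δ 0 (:1 :+ ν) :* (y :* q) :- :δ 0 (:ι 0) :* (:1 :* r)) :=
      d :* ((ν :+ :1) :^ 4 :* y :* q))
    refl d ν (x ^ (n ℕ.+ 1)) (p 1 (n ℕ.+ 1)) (p 1 0)
  -- From here on the polynomial is the j-th difference at n + 1 and the constant its value at 0,
  -- for j = 1 to 4. The values at 0 are 1, 14 = 2 * 7, 36 = 12 * 3 and 24, with 2, 12 and 24 drawn
  -- out in front.
  term₂ = solve 6 (λ d ν x y q r →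
      d :^ 2 :* (:δ 1 (:1 :+ ν) :* (y :* q) :- :δ 1 (:ι 0) :* (x :^ 1 :* r)) :=
      d :^ 2 :* ((:ι 4 :* ν :^ 3 :+ :ι 18 :* ν :^ 2 :+ :ι 28 :* ν :+ :ι 15) :* y :* q :- x :* r))
    refl d ν x (x ^ (n ℕ.+ 2)) (p 2 (n ℕ.+ 2)) (p 2 1)
  term₃ = solve 6 (λ d ν x y q r →
      d :^ 3 :* (:δ 2 (:1 :+ ν) :* (y :* q) :- :δ 2 (:ι 0) :* (x :^ 2 :* r)) :=
      :ι 2 :* d :^ 3 :* ((:ι 6 :* ν :^ 2 :+ :ι 24 :* ν :+ :ι 25) :* y :* q :- :ι 7 :* x :^ 2 :* r))
    refl d ν x (x ^ (n ℕ.+ 3)) (p 3 (n ℕ.+ 3)) (p 3 2)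
  term₄ = solve 6 (λ d ν x y q r →
      d :^ 4 :* (:δ 3 (:1 :+ ν) :* (y :* q) :- :δ 3 (:ι 0) :* (x :^ 3 :* r)) :=
      :ι 12 :* d :^ 4 :* ((:ι 2 :* ν :+ :ι 5) :* y :* q :- :ι 3 :* x :^ 3 :* r))
    refl d ν x (x ^ (n ℕ.+ 4)) (p 4 (n ℕ.+ 4)) (p 4 3)
  term₅ = solve 6 (λ d ν x y q r →
      d :^ 5 :* (:δ 4 (:1 :+ ν) :* (y :* q) :- :δ 4 (:ι 0) :* (x :^ 4 :* r)) :=
      :ι 24 :* d :^ 5 :* (y :* q :- x :^ 4 :* r))
    refl d ν x (x ^ (n ℕ.+ 5)) (p 5 (n ℕ.+ 5)) (p 5 4)
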